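{- Let $[\widehat{0},\widehat{1}]$ be an Eulerian poset of rank $\rho(\widehat{1})\geq 1$. Its short toric polynomial satisfies the recurrence $$ \operatorname{t}([\widehat{0},\widehat{1}),x)=U_{\geq 0}\left((x^{ -1}-x)^{\rho(\widehat{1})-1} +\sum_{\widehat{0}<p<\widehat{1}} U_{\geq 1}\left(\operatorname{t}([\widehat{0},p),x)\, (x-x^{ -1})\right)(x^{ -1}-x)^{\rho(\widehat{1})-\rho(p)-1}\right). $$
   Context: A graded poset is a finite poset with a unique minimum $\widehat{0}$, a unique maximum $\widehat{1}$ and a rank function $\rho:P\to\mathbb{N}$ with $\rho(\widehat{0})=0$ and $\rho(y)=\rho(x)+1$ whenever $y$ covers $x$; its rank is $\rho(\widehat{1})$. It is Eulerian if $\sum_{z\in[u,v]}(-1)^{\rho(z)}=0$ for all $u<v$. Write $[\widehat{0},p)=\{q: q<p\}$; the intervals $[\widehat{0},p]$ of an Eulerian poset are Eulerian. Stanley's toric polynomials: $f(\emptyset,x)=g(\emptyset,x)=1$ ($\emptyset$ being $[\widehat{0},\widehat{1})$ for the Eulerian poset of rank $0$), and for an Eulerian poset $[\widehat{0},\widehat{1}]$ of rank at least $1$, $$f([\widehat{0},\widehat{1}),x)=\sum_{p\in[\widehat{0},\widehat{1})} g([\widehat{0},p),x)(x-1)^{\rho(\widehat{1})-1-\rho(p)},$$ $$g([\widehat{0},\widehat{1}),x)=\sum_{i=0}^{\lfloor(\rho(\widehat{1})-1)/2\rfloor}\left([x^i]f([\widehat{0},\widehat{1}),x)-[x^{i-1}]f([\widehat{0},\widehat{1}),x)\right)x^i,$$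 where $[x^i]$ denotes the coefficient of $x^i$. By a theorem of Stanley, if the rank is $n+1$ then $f([\widehat{0},\widehat{1}),x)$ has degree $n$ and satisfies $x^nf([\widehat{0},\widehat{1}),1/x)=f([\widehat{0},\widehat{1}),x)$. Short toric polynomial: for an Eulerian poset of rank $n+1$, $\operatorname{t}([\widehat{0},\widehat{1}),x)$ is the unique polynomial $q(x)$ of degree $n$ with $q(x)=(-1)^nq(-x)$ and $f([\widehat{0},\widehat{1}),x)=x^{n/2}\left(q(\sqrt{x})+q(1/\sqrt{x})-q(0)\right)$; equivalently, $q(x)$ is obtained from $x^{n}f([\widehat{0},\widehat{1}),x^{ -2})$ by discarding all terms of negative degree. Also $\operatorname{t}(\emptyset,x)=1$. For $z\in\mathbb{Z}$, $U_{\geq z}$ is the linear operator on Laurent polynomials in $x$ that discards all terms of degree less than $z$. -}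

module Defs where

open import Level using (Level; _⊔_) renaming (suc to lsuc)
open import Data.Integer.Base as ℤ using (ℤ; +_; 0ℤ; 1ℤ; -1ℤ; ∣_∣)
open import Data.Integer.Properties as ℤ using ()
open import Data.List.Base using (List; []; _∷_; _++_; map; foldr; filter; upTo; concatMap)
open import Data.List.Membership.Propositional using (_∈_)
open import Data.List.Relation.Unary.Unique.Propositional using (Unique)
open import Data.Nat.Base as ℕ using (ℕ; zero; suc; ⌊_/2⌋)
open import Data.Product.Base using (_×_; _,_)
open import Relation.Binary.Core using (Rel)
open import Relation.Binary.Definitions using (Decidable; Minimum; Maximum)
open import Relation.Binary.PropositionalEquality using (_≡_; _≢_)
open import Relation.Binary.Structures using (IsDecPartialOrder)
open import Relation.Nullary.Decidable using (yes; no; _×-dec_)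
open import Relation.Nullary.Negation using (¬_)
import Relation.Binary.Construct.NonStrictToStrict as ToStrict

private
  variable
    a ℓ : Level

------------------------------------------------------------------------
-- Laurent polynomials over ℤ

-- A list of pairs (e , c) stands for the sum of its terms c·xᵉ. Exponents may
-- repeat and coefficients may vanish, so equality is _≈_ rather than _≡_.

Laurent : Set
Laurent = List (ℤ × ℤ)

coeff : Laurent → ℤ → ℤ
coeff []             k = 0ℤ
coeff ((e , c) ∷ p) k with e ℤ.≟ k
... | yes _ = c ℤ.+ coeff p k
... | no  _ = coeff p k

infix 4 _≈_
_≈_ : Rel Laurent _
p ≈ q = ∀ k → coeff p k ≡ coeff q k

monomial : ℤ → ℤ → Laurent
monomial c e = (e , c) ∷ []

constant : ℤ → Laurent
constant c = monomial c 0ℤ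

x^_ : ℤ → Laurent
x^ e = monomial 1ℤ e

0ᴸ 1ᴸ x x⁻¹ : Laurent
0ᴸ  = []
1ᴸ  = constant 1ℤ
x   = x^ 1ℤ
x⁻¹ = x^ -1ℤ

infix  9 x^_
infixl 6 _+_ _-_
infixl 7 _*_
infixr 8 _^_

_+_ : Laurent → Laurent → Laurent
_+_ = _++_

-_ : Laurent → Laurent
-_ = map λ (e , c) → e , ℤ.- c

_-_ : Laurent → Laurent → Laurent
p - q = p + (- q)

_*_ : Laurent → Laurent → Laurent
p * q = concatMap (λ (e , c) → map (λ (e′ , c′) → e ℤ.+ e′ , c ℤ.* c′) q) p

_^_ : Laurent → ℕ → Laurent
p ^ zero  = 1ᴸ
p ^ suc n = p * p ^ n

∑ : {A : Set a} → List A → (A → Laurent) → Laurent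
∑ is f = foldr (λ i s → f i + s) 0ᴸ is

-- p ⟨x^ m ⟩ is p(xᵐ), and p ⟨-x⟩ is p(-x).

_⟨x^_⟩ : Laurent → ℤ → Laurent
p ⟨x^ m ⟩ = map (λ (e , c) → m ℤ.* e , c) p

_⟨-x⟩ : Laurent → Laurent
_⟨-x⟩ = map λ (e , c) → e , -1ℤ ℤ.^ ∣ e ∣ ℤ.* c

U≥ : ℤ → Laurent → Laurent
U≥ z = filter λ (e , _) → z ℤ.≤? e

record IsPolynomialOfDegree (n : ℕ) (q : Laurent) : Set where
  field
    polynomial : ∀ k → k ℤ.< 0ℤ → coeff q k ≡ 0ℤ
    bounded    : ∀ k → + n ℤ.< k → coeff q k ≡ 0ℤ
    leading    : coeff q (+ n) ≢ 0ℤ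

------------------------------------------------------------------------
-- Graded and Eulerian posets

record GradedPoset a ℓ : Set (lsuc (a ⊔ ℓ)) where
  infix 4 _≤_ _⋖_
  field
    Carrier           : Set a
    _≤_               : Rel Carrier ℓ
    isDecPartialOrder : IsDecPartialOrder _≡_ _≤_

    elements          : List Carrier
    elements-complete : ∀ p → p ∈ elements
    elements-unique   : Unique elements

  open IsDecPartialOrder isDecPartialOrder public using (_≟_; _≤?_)
  open ToStrict _≡_ _≤_ public using (_<_)

  _<?_ : Decidable _<_
  _<?_ = ToStrict.<-decidable _≡_ _≤_ _≟_ _≤?_

  _⋖_ : Rel Carrier (a ⊔ ℓ)
  p ⋖ q = p < q × (∀ r → ¬ (p < r × r < q))

  field
    0̂ 1̂     : Carrier
    minimum : Minimum _≤_ 0̂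
    maximum : Maximum _≤_ 1̂
    ρ       : Carrier → ℕ
    ρ-0̂     : ρ 0̂ ≡ 0
    ρ-⋖     : ∀ {p q} → p ⋖ q → ρ q ≡ suc (ρ p)

  rank : ℕ
  rank = ρ 1̂

  [_,_] [_,_⟩ ⟨_,_⟩ : Carrier → Carrier → List Carrier
  [ u , v ] = filter (λ z → u ≤? z ×-dec z ≤? v) elements
  [ u , v ⟩ = filter (λ z → u ≤? z ×-dec z <? v) elements
  ⟨ u , v ⟩ = filter (λ z → u <? z ×-dec z <? v) elements

  IsEulerian : Set (a ⊔ ℓ)
  IsEulerian = ∀ {u v} → u < v →
    foldr ℤ._+_ 0ℤ (map (λ z → -1ℤ ℤ.^ ρ z) [ u , v ]) ≡ 0ℤ

------------------------------------------------------------------------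
-- Toric polynomials of the lower intervals of a graded poset

module _ (P : GradedPoset a ℓ) where
  open GradedPoset P

  fFrom : (Carrier → Laurent) → Carrier → Laurent
  fFrom g p with ρ p
  ... | zero  = 1ᴸ
  ... | suc n = ∑ [ 0̂ , p ⟩ λ q → g q * (x - 1ᴸ) ^ (n ℕ.∸ ρ q)

  gFrom : Laurent → Carrier → Laurent
  gFrom f p with ρ p
  ... | zero  = 1ᴸ
  ... | suc n = ∑ (upTo (suc ⌊ n /2⌋)) λ i →
                  monomial (coeff f (+ i) ℤ.- coeff f (+ i ℤ.- 1ℤ)) (+ i)

  -- Recursion depth k gives the correct value at every p of rank at most k.

  toricG′ : ℕ → Carrier → Laurent
  toricG′ zero    p = 1ᴸ
  toricG′ (suc k) p = gFrom (fFrom (toricG′ k) p) p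

  -- g([0̂,p),x) and f([0̂,p),x)

  toricG toricF : Carrier → Laurent
  toricG p = toricG′ (ρ p) p
  toricF   = fFrom toricG

-- The identity f(x) = x^{n/2} (q(√x) + q(1/√x) - q(0)) is written with √x
-- renamed to x.

record IsShortToricOf (n : ℕ) (f q : Laurent) : Set where
  field
    degree   : IsPolynomialOfDegree n q
    parity   : q ≈ constant (-1ℤ ℤ.^ n) * q ⟨-x⟩
    identity : f ⟨x^ + 2 ⟩ ≈ x^ (+ n) * (q + q ⟨x^ -1ℤ ⟩ - constant (coeff q 0ℤ))

-- q is t([0̂,p),x); for rank 0 the half-open interval is empty and t(∅,x) = 1.

IsShortToric : (P : GradedPoset a ℓ) → GradedPoset.Carrier P → Laurent → Set
IsShortToric P p q with GradedPoset.ρ P p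
... | zero  = q ≈ 1ᴸ
... | suc n = IsShortToricOf n (toricF P p) q

{-# OPTIONS --safe #-}

-- Let F = f([0̂,1̂),x⁻²), where the rank is n + 1. The defining identity of t makes f
-- palindromic and gives t = U≥0 (xⁿ F). For a proper p of rank m + 1 the same formula turns the
-- differences of consecutive coefficients of f([0̂,p),x), which are the coefficients of
-- g([0̂,p),x), into x^{m+1} g([0̂,p),x⁻²) = U≥1 (t([0̂,p),x) (x - x⁻¹)). Since
-- x (x⁻² - 1) = x⁻¹ - x, distributing xⁿ = x^ρ(p) x^{n-ρ(p)} over the sum defining f yields
-- the recurrence.

module Submission where

open import Defs
open import Data.Integer.Base using (+_)
open import Data.Nat.Base using (_∸_) renaming (_≤_ to _≤ℕ_)

open import Data.Integer.Base as ℤ using (ℤ; 0ℤ; 1ℤ; -1ℤ; -[1+_])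
open import Data.Integer.Divisibility.Signed using (_∣_; _∣?_; divides)
import Data.Integer.Properties as ℤ
open import Data.Integer.Tactic.RingSolver using (solve-∀)
open import Data.List.Base using (List; []; _∷_; _++_; map; upTo)
open import Data.List.Membership.Propositional using (_∈_)
open import Data.List.Membership.Propositional.Properties using (∈-filter⁺; ∈-filter⁻; ∈-upTo⁺; ∈-upTo⁻)
open import Data.List.Membership.Propositional.Properties.WithK using (unique∧set⇒bag)
open import Data.List.Properties using (++-identityʳ; map-++; concatMap-++)
open import Data.List.Relation.Binary.BagAndSetEquality using (∼bag⇒↭)
open import Data.List.Relation.Binary.Permutation.Propositional as Perm using (_↭_)
import Data.List.Relation.Unary.All as All
import Data.List.Relation.Unary.AllPairs as AllPairs
open import Data.List.Relation.Unary.Any using (here; there)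
open import Data.List.Relation.Unary.Unique.Propositional using (Unique)
open import Data.List.Relation.Unary.Unique.Propositional.Properties using (upTo⁺; filter⁺)
open import Data.Nat.Base as ℕ using (ℕ; zero; suc; ⌊_/2⌋)
import Data.Nat.Properties as ℕ
open import Data.Product.Base using (_×_; _,_; proj₁; proj₂)
open import Function.Base using (id; _∘_)
open import Function.Bundles using (mk⇔)
open import Level using (Level)
import Relation.Binary.Construct.NonStrictToStrict as ToStrict
open import Relation.Binary.PropositionalEquality
open import Relation.Binary.Structures using (IsDecPartialOrder)
open import Relation.Nullary.Decidable using (yes; no; _×-dec_)
open import Relation.Nullary.Negation using (¬_; contradiction)

private
  variable
    a ℓ : Level
    A : Set a

-- Coefficients

coeff-++ : ∀ p q k → coeff (p ++ q) k ≡ coeff p k ℤ.+ coeff q k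
coeff-++ []            q k = sym (ℤ.+-identityˡ _)
coeff-++ ((e , c) ∷ p) q k with e ℤ.≟ k
... | yes _ = trans (cong (ℤ._+_ c) (coeff-++ p q k)) (sym (ℤ.+-assoc c _ _))
... | no  _ = coeff-++ p q k

coeff-monomial-≡ : ∀ {c e k} → e ≡ k → coeff (monomial c e) k ≡ c
coeff-monomial-≡ {e = e} {k} e≡k with e ℤ.≟ k
... | yes _   = ℤ.+-identityʳ _
... | no  e≢k = contradiction e≡k e≢k

coeff-monomial-≢ : ∀ {c e k} → e ≢ k → coeff (monomial c e) k ≡ 0ℤ
coeff-monomial-≢ {e = e} {k} e≢k with e ℤ.≟ k
... | yes e≡k = contradiction e≡k e≢k
... | no  _   = refl

module _ (φ h : ℤ → ℤ) (h-0 : h 0ℤ ≡ 0ℤ) (h-+ : ∀ c d → h (c ℤ.+ d) ≡ h c ℤ.+ h d) where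

  -- Additivity of `h` carries it through the sum over repeated exponents, and `j` is the only
  -- exponent that `φ` sends to `k`. This one computation covers both the substitution of a power of
  -- x and multiplication by a monomial.
  coeff-map : ∀ {k j} → (∀ e → φ e ≡ k → e ≡ j) → φ j ≡ k →
              ∀ p → coeff (map (λ (e , c) → φ e , h c) p) k ≡ h (coeff p j)
  coeff-map inj φj≡k [] = sym h-0
  coeff-map {k} {j} inj φj≡k ((e , c) ∷ p) with φ e ℤ.≟ k | e ℤ.≟ j
  ... | yes _    | yes _    = trans (cong (ℤ._+_ (h c)) (coeff-map inj φj≡k p)) (sym (h-+ c _))
  ... | yes φe≡k | no  e≢j  = contradiction (inj e φe≡k) e≢j
  ... | no  φe≢k | yes refl = contradiction φj≡k φe≢k
  ... | no  _    | no  _    = coeff-map inj φj≡k p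

coeff-⟨x^⟩ : ∀ m .{{_ : ℤ.NonZero m}} p j → coeff (p ⟨x^ m ⟩) (m ℤ.* j) ≡ coeff p j
coeff-⟨x^⟩ m p j =
  coeff-map (m ℤ.*_) id refl (λ _ _ → refl) (λ e → ℤ.*-cancelˡ-≡ m e j) refl p

coeff-⟨x^⟩-∤ : ∀ m p {k} → ¬ m ∣ k → coeff (p ⟨x^ m ⟩) k ≡ 0ℤ
coeff-⟨x^⟩-∤ m []            m∤k = refl
coeff-⟨x^⟩-∤ m ((e , c) ∷ p) {k} m∤k with m ℤ.* e ℤ.≟ k
... | yes me≡k = contradiction (divides e (trans (sym me≡k) (ℤ.*-comm m e))) m∤k
... | no  _    = coeff-⟨x^⟩-∤ m p m∤k

coeff-⟨x^-1⟩ : ∀ p k → coeff (p ⟨x^ -1ℤ ⟩) k ≡ coeff p (ℤ.- k)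
coeff-⟨x^-1⟩ p k = subst (λ i → coeff (p ⟨x^ -1ℤ ⟩) i ≡ coeff p (ℤ.- k))
  (lemma k) (coeff-⟨x^⟩ -1ℤ p (ℤ.- k))
  where
  lemma : ∀ k → -1ℤ ℤ.* (ℤ.- k) ≡ k
  lemma k = trans (ℤ.-1*i≡-i (ℤ.- k)) (ℤ.neg-involutive k)

module _ {z : ℤ} where

  coeff-U≥ : ∀ p {k} → z ℤ.≤ k → coeff (U≥ z p) k ≡ coeff p k
  coeff-U≥ []            z≤k = refl
  coeff-U≥ ((e , c) ∷ p) {k} z≤k with z ℤ.≤? e
  ... | yes _ with e ℤ.≟ k
  ...   | yes _ = cong (ℤ._+_ c) (coeff-U≥ p z≤k)
  ...   | no  _ = coeff-U≥ p z≤k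
  coeff-U≥ ((e , c) ∷ p) {k} z≤k | no z≰e with e ℤ.≟ k
  ...   | yes refl = contradiction z≤k z≰e
  ...   | no  _    = coeff-U≥ p z≤k

  coeff-U≥-≰ : ∀ p {k} → ¬ z ℤ.≤ k → coeff (U≥ z p) k ≡ 0ℤ
  coeff-U≥-≰ []            z≰k = refl
  coeff-U≥-≰ ((e , c) ∷ p) {k} z≰k with z ℤ.≤? e
  ... | no  _ = coeff-U≥-≰ p z≰k
  ... | yes z≤e with e ℤ.≟ k
  ...   | yes refl = contradiction z≤e z≰k
  ...   | no  _    = coeff-U≥-≰ p z≰k

  U≥-cong : ∀ p q → p ≈ q → U≥ z p ≈ U≥ z q
  U≥-cong p q p≈q k with z ℤ.≤? k
  ... | yes z≤k = trans (coeff-U≥ p z≤k) (trans (p≈q k) (sym (coeff-U≥ q z≤k)))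
  ... | no  z≰k = trans (coeff-U≥-≰ p z≰k) (sym (coeff-U≥-≰ q z≰k))

+-cong : ∀ p p′ q q′ → p ≈ p′ → q ≈ q′ → p + q ≈ p′ + q′
+-cong p p′ q q′ p≈p′ q≈q′ k =
  trans (coeff-++ p q k) (trans (cong₂ ℤ._+_ (p≈p′ k) (q≈q′ k)) (sym (coeff-++ p′ q′ k)))

coeff-monomial-* : ∀ c e q k → coeff (monomial c e * q) k ≡ c ℤ.* coeff q (k ℤ.- e)
coeff-monomial-* c e q k = trans
  (cong (λ r → coeff r k) (++-identityʳ (map (λ (e′ , c′) → e ℤ.+ e′ , c ℤ.* c′) q)))
  (coeff-map (λ d → e ℤ.+ d) (c ℤ.*_) (ℤ.*-zeroʳ c) (ℤ.*-distribˡ-+ c)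
    (λ { d refl → lemma₁ d e }) (lemma₂ k e) q)
  where
  lemma₁ : ∀ d e → d ≡ e ℤ.+ d ℤ.- e
  lemma₁ = solve-∀
  lemma₂ : ∀ k e → e ℤ.+ (k ℤ.- e) ≡ k
  lemma₂ = solve-∀

coeff-x^-* : ∀ e q k → coeff (x^ e * q) k ≡ coeff q (k ℤ.- e)
coeff-x^-* e q k = trans (coeff-monomial-* 1ℤ e q k) (ℤ.*-identityˡ _)

*-zeroʳ : ∀ p → p * [] ≡ []
*-zeroʳ []      = refl
*-zeroʳ (_ ∷ p) = *-zeroʳ p

-- `_*_` recurses on its left factor; this expansion along the right factor makes induction on that
-- factor possible.
coeff-*-∷ : ∀ p e c r k →
            coeff (p * ((e , c) ∷ r)) k ≡ coeff p (k ℤ.- e) ℤ.* c ℤ.+ coeff (p * r) k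
coeff-*-∷ []            e c r k = refl
coeff-*-∷ ((d , b) ∷ p) e c r k = begin
  coeff (monomial (b ℤ.* c) (d ℤ.+ e) + (s ++ p * ((e , c) ∷ r))) k
    ≡⟨ coeff-++ (monomial (b ℤ.* c) (d ℤ.+ e)) _ k ⟩
  coeff (monomial (b ℤ.* c) (d ℤ.+ e)) k ℤ.+ coeff (s ++ p * ((e , c) ∷ r)) k
    ≡⟨ cong₂ ℤ._+_ first (trans (coeff-++ s _ k) (cong (ℤ._+_ (coeff s k)) (coeff-*-∷ p e c r k))) ⟩
  coeff (monomial b d) (k ℤ.- e) ℤ.* c
    ℤ.+ (coeff s k ℤ.+ (coeff p (k ℤ.- e) ℤ.* c ℤ.+ coeff (p * r) k))
    ≡⟨ lemma (coeff (monomial b d) (k ℤ.- e)) (coeff p (k ℤ.- e)) c (coeff s k) _ ⟩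
  (coeff (monomial b d) (k ℤ.- e) ℤ.+ coeff p (k ℤ.- e)) ℤ.* c
    ℤ.+ (coeff s k ℤ.+ coeff (p * r) k)
    ≡⟨ cong₂ (λ u v → u ℤ.* c ℤ.+ v) (coeff-++ (monomial b d) p _) (coeff-++ s (p * r) k) ⟨
  coeff ((d , b) ∷ p) (k ℤ.- e) ℤ.* c ℤ.+ coeff (s ++ p * r) k ∎
  where
  open ≡-Reasoning
  s = map (λ (e′ , c′) → d ℤ.+ e′ , b ℤ.* c′) r
  lemma : ∀ u v c w z → u ℤ.* c ℤ.+ (w ℤ.+ (v ℤ.* c ℤ.+ z)) ≡ (u ℤ.+ v) ℤ.* c ℤ.+ (w ℤ.+ z)
  lemma = solve-∀
  shift₁ : ∀ d e → d ≡ d ℤ.+ e ℤ.- e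
  shift₁ = solve-∀
  shift₂ : ∀ k e → k ℤ.- e ℤ.+ e ≡ k
  shift₂ = solve-∀
  first : coeff (monomial (b ℤ.* c) (d ℤ.+ e)) k ≡ coeff (monomial b d) (k ℤ.- e) ℤ.* c
  first with d ℤ.+ e ℤ.≟ k
  ... | yes refl = trans (ℤ.+-identityʳ _)
    (cong (ℤ._* c) (sym (coeff-monomial-≡ (shift₁ d e))))
  ... | no d+e≢k = sym (cong (ℤ._* c)
    (coeff-monomial-≢ {b} {d} {k ℤ.- e} λ d≡k-e → d+e≢k (trans (cong (ℤ._+ e) d≡k-e) (shift₂ k e))))

-- The induction is on `r`: `p` and `p′` agree only in their coefficients, so their term lists need
-- not have a common structure.
*-congʳ : ∀ p p′ → p ≈ p′ → ∀ r → p * r ≈ p′ * r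
*-congʳ p p′ p≈p′ []            k = cong (λ s → coeff s k) (trans (*-zeroʳ p) (sym (*-zeroʳ p′)))
*-congʳ p p′ p≈p′ ((e , c) ∷ r) k = begin
  coeff (p * ((e , c) ∷ r)) k                       ≡⟨ coeff-*-∷ p e c r k ⟩
  coeff p (k ℤ.- e) ℤ.* c ℤ.+ coeff (p * r) k
    ≡⟨ cong₂ (λ u v → u ℤ.* c ℤ.+ v) (p≈p′ _) (*-congʳ p p′ p≈p′ r k) ⟩
  coeff p′ (k ℤ.- e) ℤ.* c ℤ.+ coeff (p′ * r) k     ≡⟨ coeff-*-∷ p′ e c r k ⟨
  coeff (p′ * ((e , c) ∷ r)) k                      ∎
  where open ≡-Reasoning

-- Identities holding for the term lists themselves

*-distribʳ : ∀ p q r → (p + q) * r ≡ p * r + q * r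
*-distribʳ p q r = concatMap-++ _ p q

scale-* : ∀ d b q r → map (λ (e , c) → d ℤ.+ e , b ℤ.* c) q * r
                    ≡ map (λ (e , c) → d ℤ.+ e , b ℤ.* c) (q * r)
scale-* d b []            r = refl
scale-* d b ((e , c) ∷ q) r = trans (cong₂ _++_ (lemma r) (scale-* d b q r)) (sym (map-++ _ _ (q * r)))
  where
  lemma : ∀ r → map (λ (e′ , c′) → d ℤ.+ e ℤ.+ e′ , b ℤ.* c ℤ.* c′) r
              ≡ map (λ (e , c) → d ℤ.+ e , b ℤ.* c) (map (λ (e′ , c′) → e ℤ.+ e′ , c ℤ.* c′) r)
  lemma []              = refl
  lemma ((e′ , c′) ∷ r) = cong₂ _∷_ (cong₂ _,_ (ℤ.+-assoc d e e′) (ℤ.*-assoc b c c′)) (lemma r)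

*-assoc : ∀ p q r → (p * q) * r ≡ p * (q * r)
*-assoc []            q r = refl
*-assoc ((e , c) ∷ p) q r =
  trans (*-distribʳ (map _ q) (p * q) r) (cong₂ _++_ (scale-* e c q r) (*-assoc p q r))

-- With a single term as one factor, both products list their terms in the order of `p`.
x^-*-comm : ∀ e p → x^ e * p ≡ p * x^ e
x^-*-comm e []            = refl
x^-*-comm e ((d , c) ∷ p) = cong₂ _∷_ (cong₂ _,_ (ℤ.+-comm e d) (ℤ.*-comm 1ℤ c)) (x^-*-comm e p)

*-identityˡ : ∀ p → 1ᴸ * p ≡ p
*-identityˡ []            = refl
*-identityˡ ((e , c) ∷ p) = cong₂ _∷_ (cong₂ _,_ (ℤ.+-identityˡ e) (ℤ.*-identityˡ c)) (*-identityˡ p)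

-- Distributing from the left keeps the order of the terms because the left factor is a single term;
-- longer left factors would interleave them.
x^-*-distribˡ : ∀ e p q → x^ e * (p + q) ≡ x^ e * p + x^ e * q
x^-*-distribˡ e []            q = refl
x^-*-distribˡ e ((d , c) ∷ p) q = cong (_ ∷_) (x^-*-distribˡ e p q)

*-⟨x^⟩ : ∀ m p q → (p * q) ⟨x^ m ⟩ ≡ p ⟨x^ m ⟩ * q ⟨x^ m ⟩
*-⟨x^⟩ m []            q = refl
*-⟨x^⟩ m ((e , c) ∷ p) q = trans (map-++ _ _ (p * q)) (cong₂ _++_ (lemma q) (*-⟨x^⟩ m p q))
  where
  lemma : ∀ q → (map (λ (e′ , c′) → e ℤ.+ e′ , c ℤ.* c′) q) ⟨x^ m ⟩
              ≡ map (λ (e′ , c′) → m ℤ.* e ℤ.+ e′ , c ℤ.* c′) (q ⟨x^ m ⟩)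
  lemma []             = refl
  lemma ((e′ , c′) ∷ q) = cong₂ _∷_ (cong (_, c ℤ.* c′) (ℤ.*-distribˡ-+ m e e′)) (lemma q)

-- The weighted substitution p ↦ xⁿ p(x⁻²)

homogenize : ℕ → Laurent → Laurent
homogenize n p = x^ (+ n) * p ⟨x^ ℤ.- + 2 ⟩

homogenize-+ : ∀ n p q → homogenize n (p + q) ≡ homogenize n p + homogenize n q
homogenize-+ n p q =
  trans (cong (x^ (+ n) *_) (map-++ _ p q)) (x^-*-distribˡ (+ n) (p ⟨x^ ℤ.- + 2 ⟩) _)

homogenize-∑ : ∀ n (is : List A) f → homogenize n (∑ is f) ≡ ∑ is (homogenize n ∘ f)
homogenize-∑ n []       f = refl
homogenize-∑ n (i ∷ is) f =
  trans (homogenize-+ n (f i) _) (cong (_+_ (homogenize n (f i))) (homogenize-∑ n is f))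

-- Substitution is multiplicative, and the weight x^{m+n} is shared out by moving xⁿ past the first
-- factor.
homogenize-* : ∀ m n p q → homogenize (m ℕ.+ n) (p * q) ≡ homogenize m p * homogenize n q
homogenize-* m n p q = begin
  x^ (+ (m ℕ.+ n)) * (p * q) ⟨x^ ℤ.- + 2 ⟩   ≡⟨ cong (x^ (+ (m ℕ.+ n)) *_) (*-⟨x^⟩ (ℤ.- + 2) p q) ⟩
  -- The product of the two monomials computes to `x^ (+ (m ℕ.+ n))`.
  x^ (+ m) * x^ (+ n) * (p̂ * q̂)             ≡⟨ *-assoc (x^ (+ m)) (x^ (+ n)) (p̂ * q̂) ⟩
  x^ (+ m) * (x^ (+ n) * (p̂ * q̂))           ≡⟨ cong (x^ (+ m) *_) (*-assoc (x^ (+ n)) p̂ q̂) ⟨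
  x^ (+ m) * (x^ (+ n) * p̂ * q̂)             ≡⟨ cong (λ r → x^ (+ m) * (r * q̂)) (x^-*-comm (+ n) p̂) ⟩
  x^ (+ m) * (p̂ * x^ (+ n) * q̂)             ≡⟨ cong (x^ (+ m) *_) (*-assoc p̂ (x^ (+ n)) q̂) ⟩
  x^ (+ m) * (p̂ * (x^ (+ n) * q̂))           ≡⟨ *-assoc (x^ (+ m)) p̂ (x^ (+ n) * q̂) ⟨
  x^ (+ m) * p̂ * (x^ (+ n) * q̂)             ∎
  where
  open ≡-Reasoning
  p̂ = p ⟨x^ ℤ.- + 2 ⟩
  q̂ = q ⟨x^ ℤ.- + 2 ⟩

homogenize-^ : ∀ n → homogenize n ((x - 1ᴸ) ^ n) ≡ (x⁻¹ - x) ^ n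
homogenize-^ zero    = refl
homogenize-^ (suc n) = trans
  (homogenize-* 1 n (x - 1ᴸ) ((x - 1ᴸ) ^ n))
  -- x (x⁻² - 1) computes to the very term list of `x⁻¹ - x`, so the first factor is already in
  -- place.
  (cong ((x⁻¹ - x) *_) (homogenize-^ n))

coeff-homogenize : ∀ n p k → coeff (homogenize n p) k ≡ coeff (p ⟨x^ ℤ.- + 2 ⟩) (k ℤ.- + n)
coeff-homogenize n p = coeff-x^-* (+ n) (p ⟨x^ ℤ.- + 2 ⟩)

-- Finite sums

∑-cong : ∀ (is : List A) {f g} → (∀ {i} → i ∈ is → f i ≡ g i) → ∑ is f ≡ ∑ is g
∑-cong []       f≡g = refl
∑-cong (i ∷ is) f≡g = cong₂ _++_ (f≡g (here refl)) (∑-cong is (f≡g ∘ there))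

∑-cong-≈ : ∀ (is : List A) f g → (∀ {i} → i ∈ is → f i ≈ g i) → ∑ is f ≈ ∑ is g
∑-cong-≈ []       f g f≈g k = refl
∑-cong-≈ (i ∷ is) f g f≈g   =
  +-cong (f i) (g i) (∑ is f) (∑ is g) (f≈g (here refl)) (∑-cong-≈ is f g (f≈g ∘ there))

∑-↭ : ∀ {is js : List A} f → is ↭ js → ∑ is f ≈ ∑ js f
∑-↭ f Perm.refl                    k = refl
∑-↭ f (Perm.prep {is} {js} i is↭js)     = +-cong (f i) (f i) (∑ is f) (∑ js f) (λ _ → refl) (∑-↭ f is↭js)
∑-↭ f (Perm.trans is↭js js↭ks)     k = trans (∑-↭ f is↭js k) (∑-↭ f js↭ks k)
∑-↭ f (Perm.swap {is} {js} i j is↭js) k = begin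
  coeff (f i + (f j + ∑ is f)) k
    ≡⟨ trans (coeff-++ (f i) _ k) (cong (ℤ._+_ (coeff (f i) k)) (coeff-++ (f j) _ k)) ⟩
  coeff (f i) k ℤ.+ (coeff (f j) k ℤ.+ coeff (∑ is f) k)
    ≡⟨ lemma (coeff (f i) k) (coeff (f j) k) _ ⟩
  coeff (f j) k ℤ.+ (coeff (f i) k ℤ.+ coeff (∑ is f) k)
    ≡⟨ cong (λ s → coeff (f j) k ℤ.+ (coeff (f i) k ℤ.+ s)) (∑-↭ f is↭js k) ⟩
  coeff (f j) k ℤ.+ (coeff (f i) k ℤ.+ coeff (∑ js f) k)
    ≡⟨ trans (coeff-++ (f j) _ k) (cong (ℤ._+_ (coeff (f j) k)) (coeff-++ (f i) _ k)) ⟨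
  coeff (f j + (f i + ∑ js f)) k ∎
  where
  open ≡-Reasoning
  lemma : ∀ u v w → u ℤ.+ (v ℤ.+ w) ≡ v ℤ.+ (u ℤ.+ w)
  lemma = solve-∀

module _ (c : ℕ → ℤ) where

  coeff-∑-∉ : ∀ is {k} → (∀ {i} → i ∈ is → + i ≢ k) → coeff (∑ is λ i → monomial (c i) (+ i)) k ≡ 0ℤ
  coeff-∑-∉ []       i≢k = refl
  coeff-∑-∉ (i ∷ is) {k} i≢k = trans (coeff-++ (monomial (c i) (+ i)) _ k)
    (cong₂ ℤ._+_ (coeff-monomial-≢ (i≢k (here refl))) (coeff-∑-∉ is (i≢k ∘ there)))

  -- Since the indices are distinct, exactly one summand has exponent `j`.
  coeff-∑-∈ : ∀ {is j} → Unique is → j ∈ is → coeff (∑ is λ i → monomial (c i) (+ i)) (+ j) ≡ c j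
  coeff-∑-∈ {i ∷ is} {j} (i∉is AllPairs.∷ _) (here refl) =
    trans (coeff-++ (monomial (c i) (+ i)) _ (+ j))
    (trans (cong₂ ℤ._+_ (coeff-monomial-≡ {c i} {+ i} refl)
      (coeff-∑-∉ is λ { i∈is refl → All.lookup i∉is i∈is refl })) (ℤ.+-identityʳ _))
  coeff-∑-∈ {i ∷ is} {j} (i∉is AllPairs.∷ u) (there j∈is) =
    trans (coeff-++ (monomial (c i) (+ i)) _ (+ j))
    (trans (cong₂ ℤ._+_ (coeff-monomial-≢ λ i≡j → All.lookup i∉is j∈is (ℤ.+-injective i≡j))
      (coeff-∑-∈ u j∈is)) (ℤ.+-identityˡ _))

-- Short toric polynomials

module _ {n : ℕ} {f q : Laurent} (short : IsShortToricOf n f q) where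
  open IsShortToricOf short
  open IsPolynomialOfDegree degree

  -- Substituting 1/x for x in the defining identity cancels the factor xⁿ and leaves xⁿ f(x⁻²) =
  -- q(x) + q(1/x) - q(0).
  coeff-homogenize-short : ∀ k → coeff (homogenize n f) k ≡
    coeff q (ℤ.- k) ℤ.+ coeff q k ℤ.+ coeff (constant (ℤ.- coeff q 0ℤ)) (ℤ.- k)
  coeff-homogenize-short k = begin
    coeff (homogenize n f) k
      ≡⟨ coeff-homogenize n f k ⟩
    coeff (f ⟨x^ ℤ.- + 2 ⟩) (k ℤ.- + n)
      ≡⟨ cong (λ p → coeff p (k ℤ.- + n)) (⟨x^⟩-⟨x^-1⟩ f) ⟨
    coeff (f ⟨x^ + 2 ⟩ ⟨x^ -1ℤ ⟩) (k ℤ.- + n)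
      ≡⟨ coeff-⟨x^-1⟩ (f ⟨x^ + 2 ⟩) (k ℤ.- + n) ⟩
    coeff (f ⟨x^ + 2 ⟩) (ℤ.- (k ℤ.- + n))
      ≡⟨ identity _ ⟩
    coeff (x^ (+ n) * (q + q ⟨x^ -1ℤ ⟩ - constant (coeff q 0ℤ))) (ℤ.- (k ℤ.- + n))
      ≡⟨ coeff-x^-* (+ n) (q + q ⟨x^ -1ℤ ⟩ - constant (coeff q 0ℤ)) _ ⟩
    coeff (q + q ⟨x^ -1ℤ ⟩ - constant (coeff q 0ℤ)) (ℤ.- (k ℤ.- + n) ℤ.- + n)
      ≡⟨ cong (coeff (q + q ⟨x^ -1ℤ ⟩ - constant (coeff q 0ℤ))) (lemma k (+ n)) ⟩
    coeff (q + q ⟨x^ -1ℤ ⟩ - constant (coeff q 0ℤ)) (ℤ.- k)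
      ≡⟨ coeff-++ (q + q ⟨x^ -1ℤ ⟩) _ _ ⟩
    coeff (q + q ⟨x^ -1ℤ ⟩) (ℤ.- k) ℤ.+ coeff (constant (ℤ.- coeff q 0ℤ)) (ℤ.- k)
      ≡⟨ cong (ℤ._+ coeff (constant (ℤ.- coeff q 0ℤ)) (ℤ.- k))
           (trans (coeff-++ q _ _) (cong (ℤ._+_ (coeff q (ℤ.- k)))
             (trans (coeff-⟨x^-1⟩ q (ℤ.- k)) (cong (coeff q) (ℤ.neg-involutive k))))) ⟩
    coeff q (ℤ.- k) ℤ.+ coeff q k ℤ.+ coeff (constant (ℤ.- coeff q 0ℤ)) (ℤ.- k) ∎
    where
    open ≡-Reasoning
    lemma : ∀ k n → ℤ.- (k ℤ.- n) ℤ.- n ≡ ℤ.- k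
    lemma = solve-∀
    ⟨x^⟩-⟨x^-1⟩ : ∀ p → p ⟨x^ + 2 ⟩ ⟨x^ -1ℤ ⟩ ≡ p ⟨x^ ℤ.- + 2 ⟩
    ⟨x^⟩-⟨x^-1⟩ []            = refl
    ⟨x^⟩-⟨x^-1⟩ ((e , c) ∷ p) =
      cong₂ _∷_ (cong (_, c) (sym (ℤ.*-assoc -1ℤ (+ 2) e))) (⟨x^⟩-⟨x^-1⟩ p)

  -- In degree 0 the constant term of q occurs twice and is subtracted once. In positive degree
  -- q(1/x) contributes nothing, as q has no negative powers.
  coeff-homogenize-short-≥0 : ∀ {k} → 0ℤ ℤ.≤ k → coeff (homogenize n f) k ≡ coeff q k
  coeff-homogenize-short-≥0 {+ zero} _ = trans (coeff-homogenize-short 0ℤ)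
    (trans (cong (ℤ._+_ (coeff q 0ℤ ℤ.+ coeff q 0ℤ)) (ℤ.+-identityʳ _)) (lemma (coeff q 0ℤ)))
    where
    lemma : ∀ c → c ℤ.+ c ℤ.- c ≡ c
    lemma = solve-∀
  coeff-homogenize-short-≥0 {+ suc k} _ = trans (coeff-homogenize-short (+ suc k))
    (trans (ℤ.+-identityʳ _)
    (trans (cong (ℤ._+ coeff q (+ suc k)) (polynomial -[1+ k ] ℤ.-<+)) (ℤ.+-identityˡ _)))

  coeff-homogenize-short->n : ∀ {k} → + n ℤ.< k → coeff (homogenize n f) k ≡ 0ℤ
  coeff-homogenize-short->n {k} n<k = trans
    (coeff-homogenize-short-≥0 (ℤ.≤-trans (ℤ.+≤+ ℕ.z≤n) (ℤ.<⇒≤ n<k))) (bounded k n<k)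

  short≈U≥0 : q ≈ U≥ 0ℤ (homogenize n f)
  short≈U≥0 k with 0ℤ ℤ.≤? k
  ... | yes 0≤k = sym (trans (coeff-U≥ (homogenize n f) 0≤k) (coeff-homogenize-short-≥0 0≤k))
  ... | no  0≰k = trans (polynomial k (ℤ.≰⇒> 0≰k)) (sym (coeff-U≥-≰ (homogenize n f) 0≰k))

  -- A term of f with exponent -(j+1) would appear in xⁿ f(x⁻²) in degree n + 2(j+1), above the
  -- degree of q.
  coeff-neg : ∀ j → coeff f -[1+ j ] ≡ 0ℤ
  coeff-neg j = begin
    coeff f -[1+ j ]
      ≡⟨ coeff-⟨x^⟩ (ℤ.- + 2) f -[1+ j ] ⟨
    coeff (f ⟨x^ ℤ.- + 2 ⟩) (ℤ.- + 2 ℤ.* -[1+ j ])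
      ≡⟨ cong (coeff (f ⟨x^ ℤ.- + 2 ⟩)) (lemma (ℤ.- + 2 ℤ.* -[1+ j ]) (+ n)) ⟩
    coeff (f ⟨x^ ℤ.- + 2 ⟩) (+ n ℤ.+ ℤ.- + 2 ℤ.* -[1+ j ] ℤ.- + n)
      ≡⟨ coeff-homogenize n f (+ n ℤ.+ ℤ.- + 2 ℤ.* -[1+ j ]) ⟨
    coeff (homogenize n f) (+ n ℤ.+ ℤ.- + 2 ℤ.* -[1+ j ])
      ≡⟨ coeff-homogenize-short->n (ℤ.+<+ (ℕ.m<m+n n ℕ.z<s)) ⟩
    0ℤ ∎
    where
    open ≡-Reasoning
    lemma : ∀ k n → k ≡ n ℤ.+ k ℤ.- n
    lemma = solve-∀

-- The coefficients of g as differences of those of f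

Δ : Laurent → ℕ → ℤ
Δ f i = coeff f (+ i) ℤ.- coeff f (+ i ℤ.- 1ℤ)

-- g([0̂,p),x) in terms of f([0̂,p),x), for p of rank n + 1
gPolynomial : ℕ → Laurent → Laurent
gPolynomial n f = ∑ (upTo (suc ⌊ n /2⌋)) λ i → monomial (Δ f i) (+ i)

coeff-gPolynomial-≤ : ∀ {n f i} → i ℕ.≤ ⌊ n /2⌋ →
                      coeff (gPolynomial n f) (+ i) ≡ Δ f i
coeff-gPolynomial-≤ {n} {f} i≤ =
  coeff-∑-∈ (Δ f) (upTo⁺ (suc ⌊ n /2⌋)) (∈-upTo⁺ (ℕ.s≤s i≤))

coeff-gPolynomial-≰ : ∀ {n f i} → ¬ i ℕ.≤ ⌊ n /2⌋ → coeff (gPolynomial n f) (+ i) ≡ 0ℤ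
coeff-gPolynomial-≰ {n} {f} {i} i≰ =
  coeff-∑-∉ (Δ f) (upTo (suc ⌊ n /2⌋)) {+ i} λ { j∈ refl → i≰ (ℕ.s≤s⁻¹ (∈-upTo⁻ j∈)) }

coeff-gPolynomial-neg : ∀ {n f i} → coeff (gPolynomial n f) -[1+ i ] ≡ 0ℤ
coeff-gPolynomial-neg {n} {f} {i} =
  coeff-∑-∉ (Δ f) (upTo (suc ⌊ n /2⌋)) { -[1+ i ]} λ _ ()

n+n≤m⇒n≤⌊m/2⌋ : ∀ {m n} → n ℕ.+ n ℕ.≤ m → n ℕ.≤ ⌊ m /2⌋
n+n≤m⇒n≤⌊m/2⌋ {m} {n} n+n≤m = subst (ℕ._≤ ⌊ m /2⌋) (sym (ℕ.n≡⌊n+n/2⌋ n)) (ℕ.⌊n/2⌋-mono n+n≤m)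

n≤⌊m/2⌋⇒n+n≤m : ∀ {m n} → n ℕ.≤ ⌊ m /2⌋ → n ℕ.+ n ℕ.≤ m
n≤⌊m/2⌋⇒n+n≤m {m} {n} n≤ = subst (n ℕ.+ n ℕ.≤_) (ℕ.⌊n/2⌋+⌈n/2⌉≡n m)
  (ℕ.+-mono-≤ n≤ (ℕ.≤-trans n≤ (ℕ.⌊n/2⌋≤⌈n/2⌉ m)))

-- Truncation formula for x^{n+1} g(x⁻²)

module _ {n : ℕ} {f q : Laurent} (short : IsShortToricOf n f q) where
  open ≡-Reasoning

  private
    fˣ gˣ : ℤ → ℤ
    fˣ = coeff (f ⟨x^ ℤ.- + 2 ⟩)
    gˣ = coeff (gPolynomial n f ⟨x^ ℤ.- + 2 ⟩)

  -- The coefficient is that of q at k - 1 minus that at k + 1. For k ≥ 1 both degrees are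
  -- nonnegative, where q agrees with xⁿ f(x⁻²); hence the cutoff at degree 1.
  coeff-*-[x-x⁻¹] : ∀ {k} → 1ℤ ℤ.≤ k →
    coeff (q * (x - x⁻¹)) k ≡ fˣ (k ℤ.- + suc n) ℤ.- fˣ (k ℤ.- + suc n ℤ.+ + 2)
  coeff-*-[x-x⁻¹] {k} 1≤k = begin
    coeff (q * (x - x⁻¹)) k
      ≡⟨ coeff-*-∷ q 1ℤ 1ℤ _ k ⟩
    coeff q (k ℤ.- 1ℤ) ℤ.* 1ℤ ℤ.+ coeff (q * ((-1ℤ , -1ℤ) ∷ [])) k
      ≡⟨ cong (λ c → coeff q (k ℤ.- 1ℤ) ℤ.* 1ℤ ℤ.+ c)
           (trans (coeff-*-∷ q -1ℤ -1ℤ [] k)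
             (cong (λ s → coeff q (k ℤ.+ 1ℤ) ℤ.* -1ℤ ℤ.+ coeff s k) (*-zeroʳ q))) ⟩
    coeff q (k ℤ.- 1ℤ) ℤ.* 1ℤ ℤ.+ (coeff q (k ℤ.+ 1ℤ) ℤ.* -1ℤ ℤ.+ 0ℤ)
      ≡⟨ lemma (coeff q (k ℤ.- 1ℤ)) (coeff q (k ℤ.+ 1ℤ)) ⟩
    coeff q (k ℤ.- 1ℤ) ℤ.- coeff q (k ℤ.+ 1ℤ)
      ≡⟨ cong₂ ℤ._-_ (coeff-short 0≤k-1) (coeff-short 0≤k+1) ⟩
    fˣ (k ℤ.- 1ℤ ℤ.- + n) ℤ.- fˣ (k ℤ.+ 1ℤ ℤ.- + n)
      ≡⟨ cong₂ (λ i j → fˣ i ℤ.- fˣ j) (shift₁ k (+ n)) (shift₂ k (+ n)) ⟩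
    fˣ (k ℤ.- + suc n) ℤ.- fˣ (k ℤ.- + suc n ℤ.+ + 2) ∎
    where
    coeff-short : ∀ {k} → 0ℤ ℤ.≤ k → coeff q k ≡ fˣ (k ℤ.- + n)
    coeff-short {k} 0≤k = trans (sym (coeff-homogenize-short-≥0 short 0≤k)) (coeff-homogenize n f k)
    0≤k-1 : 0ℤ ℤ.≤ k ℤ.- 1ℤ
    0≤k-1 = ℤ.i≤j⇒0≤j-i 1≤k
    0≤k+1 : 0ℤ ℤ.≤ k ℤ.+ 1ℤ
    0≤k+1 = ℤ.≤-trans (ℤ.≤-trans (ℤ.+≤+ ℕ.z≤n) 1≤k) (ℤ.i≤i+j k 1ℤ)
    lemma : ∀ u v → u ℤ.* 1ℤ ℤ.+ (v ℤ.* -1ℤ ℤ.+ 0ℤ) ≡ u ℤ.- v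
    lemma = solve-∀
    shift₁ : ∀ k n → k ℤ.- 1ℤ ℤ.- n ≡ k ℤ.- (1ℤ ℤ.+ n)
    shift₁ = solve-∀
    shift₂ : ∀ k n → k ℤ.+ 1ℤ ℤ.- n ≡ k ℤ.- (1ℤ ℤ.+ n) ℤ.+ + 2
    shift₂ = solve-∀

  private
    coeff-even : ∀ p j → coeff (p ⟨x^ ℤ.- + 2 ⟩) (j ℤ.* ℤ.- + 2) ≡ coeff p j
    coeff-even p j =
      trans (cong (coeff (p ⟨x^ ℤ.- + 2 ⟩)) (ℤ.*-comm j (ℤ.- + 2))) (coeff-⟨x^⟩ (ℤ.- + 2) p j)

    -- Under x ↦ x⁻², raising the exponent by 2 lowers the index in f by 1, so the difference above
    -- is one of consecutive coefficients.
    coeff-f-even+2 : ∀ j → fˣ (j ℤ.* ℤ.- + 2 ℤ.+ + 2) ≡ coeff f (j ℤ.- 1ℤ)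
    coeff-f-even+2 j = trans (cong fˣ (lemma j)) (coeff-even f (j ℤ.- 1ℤ))
      where
      lemma : ∀ j → j ℤ.* ℤ.- + 2 ℤ.+ + 2 ≡ (j ℤ.- 1ℤ) ℤ.* ℤ.- + 2
      lemma = solve-∀

    -- For k = n + 1 - 2i, the condition k ≥ 1 reads 2i ≤ n. Thus the cutoff of `U≥ 1ℤ` corresponds
    -- exactly to the upper limit ⌊n/2⌋ in the sum defining g.
    remainder : ∀ k i → k ℤ.- + suc n ≡ + i ℤ.* ℤ.- + 2 → k ℤ.- 1ℤ ≡ + n ℤ.- + (i ℕ.+ i)
    remainder k i eq = trans (lemma₁ k (+ n)) (trans (cong (ℤ._+ + n) eq) (lemma₂ (+ i) (+ n)))
      where
      lemma₁ : ∀ k n → k ℤ.- 1ℤ ≡ k ℤ.- (1ℤ ℤ.+ n) ℤ.+ n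
      lemma₁ = solve-∀
      lemma₂ : ∀ i n → i ℤ.* ℤ.- + 2 ℤ.+ n ≡ n ℤ.- (i ℤ.+ i)
      lemma₂ = solve-∀

    1≤k⇒i≤ : ∀ k i → k ℤ.- + suc n ≡ + i ℤ.* ℤ.- + 2 → 1ℤ ℤ.≤ k → i ℕ.≤ ⌊ n /2⌋
    1≤k⇒i≤ k i eq 1≤k = n+n≤m⇒n≤⌊m/2⌋ (ℤ.drop‿+≤+
      (ℤ.0≤i-j⇒j≤i (subst (0ℤ ℤ.≤_) (remainder k i eq) (ℤ.i≤j⇒0≤j-i 1≤k))))

    i≤⇒1≤k : ∀ k i → k ℤ.- + suc n ≡ + i ℤ.* ℤ.- + 2 → i ℕ.≤ ⌊ n /2⌋ → 1ℤ ℤ.≤ k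
    i≤⇒1≤k k i eq i≤ = ℤ.0≤i-j⇒j≤i (subst (0ℤ ℤ.≤_) (sym (remainder k i eq))
      (ℤ.i≤j⇒0≤j-i (ℤ.+≤+ (n≤⌊m/2⌋⇒n+n≤m i≤))))

    odd+2 : ∀ {k} → ¬ (ℤ.- + 2) ∣ k → ¬ (ℤ.- + 2) ∣ (k ℤ.+ + 2)
    odd+2 {k} ∤k (divides j eq) = ∤k (divides (j ℤ.+ 1ℤ)
      (trans (lemma₁ k) (trans (cong (ℤ._- + 2) eq) (lemma₂ j))))
      where
      lemma₁ : ∀ k → k ≡ k ℤ.+ + 2 ℤ.- + 2
      lemma₁ = solve-∀
      lemma₂ : ∀ j → j ℤ.* ℤ.- + 2 ℤ.- + 2 ≡ (j ℤ.+ 1ℤ) ℤ.* ℤ.- + 2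
      lemma₂ = solve-∀

    coeff-g-≥1 : ∀ {k} → 1ℤ ℤ.≤ k →
      gˣ (k ℤ.- + suc n) ≡ fˣ (k ℤ.- + suc n) ℤ.- fˣ (k ℤ.- + suc n ℤ.+ + 2)
    coeff-g-≥1 {k} 1≤k with (ℤ.- + 2) ∣? (k ℤ.- + suc n)
    -- Polynomials in x⁻² have no odd powers, so all three coefficients vanish.
    ... | no ∤ = trans (coeff-⟨x^⟩-∤ _ (gPolynomial n f) ∤)
      (sym (cong₂ ℤ._-_ (coeff-⟨x^⟩-∤ _ f ∤) (coeff-⟨x^⟩-∤ _ f (odd+2 ∤))))
    ... | yes (divides j eq) = begin
      gˣ (k ℤ.- + suc n)                                    ≡⟨ cong gˣ eq ⟩
      gˣ (j ℤ.* ℤ.- + 2)                                    ≡⟨ coeff-even (gPolynomial n f) j ⟩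
      coeff (gPolynomial n f) j                             ≡⟨ lemma j eq ⟩
      coeff f j ℤ.- coeff f (j ℤ.- 1ℤ)
        ≡⟨ cong₂ ℤ._-_ (coeff-even f j) (coeff-f-even+2 j) ⟨
      fˣ (j ℤ.* ℤ.- + 2) ℤ.- fˣ (j ℤ.* ℤ.- + 2 ℤ.+ + 2)     ≡⟨ cong (λ i → fˣ i ℤ.- fˣ (i ℤ.+ + 2)) eq ⟨
      fˣ (k ℤ.- + suc n) ℤ.- fˣ (k ℤ.- + suc n ℤ.+ + 2)     ∎
      where
      lemma : ∀ j → k ℤ.- + suc n ≡ j ℤ.* ℤ.- + 2 →
              coeff (gPolynomial n f) j ≡ coeff f j ℤ.- coeff f (j ℤ.- 1ℤ)
      lemma (+ i)    eq = coeff-gPolynomial-≤ {n} {f} {i} (1≤k⇒i≤ k i eq 1≤k)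
      -- A negative index lies outside the sum defining g, and f vanishes there and at the preceding
      -- index, whose normal form is `-[1+ suc (i ℕ.+ 0) ]`.
      lemma -[1+ i ] eq = trans (coeff-gPolynomial-neg {n} {f} {i})
        (sym (cong₂ ℤ._-_ (coeff-neg short i) (coeff-neg short (suc (i ℕ.+ 0)))))

    coeff-g-≱1 : ∀ {k} → ¬ 1ℤ ℤ.≤ k → gˣ (k ℤ.- + suc n) ≡ 0ℤ
    coeff-g-≱1 {k} 1≰k with (ℤ.- + 2) ∣? (k ℤ.- + suc n)
    ... | no ∤ = coeff-⟨x^⟩-∤ _ (gPolynomial n f) ∤
    ... | yes (divides j eq) =
      trans (cong gˣ eq) (trans (coeff-even (gPolynomial n f) j) (lemma j eq))
      where
      lemma : ∀ j → k ℤ.- + suc n ≡ j ℤ.* ℤ.- + 2 → coeff (gPolynomial n f) j ≡ 0ℤ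
      lemma (+ i)    eq = coeff-gPolynomial-≰ {n} {f} {i} (λ i≤ → 1≰k (i≤⇒1≤k k i eq i≤))
      lemma -[1+ i ] eq = coeff-gPolynomial-neg {n} {f} {i}

  -- From degree 1 on, both sides are the same differences of coefficients of f. Below degree 1 the
  -- left side has no terms, because the exponents in g stop at ⌊n/2⌋.
  homogenize-gPolynomial : homogenize (suc n) (gPolynomial n f) ≈ U≥ 1ℤ (q * (x - x⁻¹))
  homogenize-gPolynomial k with 1ℤ ℤ.≤? k
  ... | yes 1≤k = trans (coeff-homogenize (suc n) (gPolynomial n f) k) (trans (coeff-g-≥1 1≤k)
    (sym (trans (coeff-U≥ (q * (x - x⁻¹)) 1≤k) (coeff-*-[x-x⁻¹] 1≤k))))
  ... | no  1≰k = trans (coeff-homogenize (suc n) (gPolynomial n f) k) (trans (coeff-g-≱1 1≰k)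
    (sym (coeff-U≥-≰ (q * (x - x⁻¹)) 1≰k)))

-- Graded posets

module _ (P : GradedPoset a ℓ) where
  open GradedPoset P
  private
    module ≤ = IsDecPartialOrder isDecPartialOrder

    <-trans : ∀ {p q r} → p < q → q < r → p < r
    <-trans = ToStrict.<-trans _≡_ _≤_ ≤.isPartialOrder

  -- Induction on a list of candidates for the elements strictly between p and q.
  ρ-mono-⊆ : ∀ cs {p q} → p < q → (∀ {r} → p < r → r < q → r ∈ cs) → ρ p ℕ.< ρ q
  ρ-mono-⊆ []       p<q ⊆cs =
    -- With no candidates left, `q` covers `p`.
    ℕ.≤-reflexive (sym (ρ-⋖ (p<q , λ { r (p<r , r<q) → contradiction (⊆cs p<r r<q) λ () })))
  ρ-mono-⊆ (c ∷ cs) {p} {q} p<q ⊆cs with p <? c ×-dec c <? q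
  -- The element `c` splits the interval and lies strictly inside neither half, so `cs` suffices for
  -- both.
  ... | yes (p<c , c<q) = ℕ.<-trans
    (ρ-mono-⊆ cs p<c λ p<r r<c → drop-≢ (proj₂ r<c) (⊆cs p<r (<-trans r<c c<q)))
    (ρ-mono-⊆ cs c<q λ c<r r<q → drop-≢ (proj₂ c<r ∘ sym) (⊆cs (<-trans p<c c<r) r<q))
    where
    drop-≢ : ∀ {r} → r ≢ c → r ∈ c ∷ cs → r ∈ cs
    drop-≢ r≢c (here r≡c)   = contradiction r≡c r≢c
    drop-≢ r≢c (there r∈cs) = r∈cs
  ... | no  c∉ = ρ-mono-⊆ cs p<q λ p<r r<q → drop p<r r<q (⊆cs p<r r<q)
    where
    drop : ∀ {r} → p < r → r < q → r ∈ c ∷ cs → r ∈ cs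
    drop p<r r<q (here refl)  = contradiction (p<r , r<q) c∉
    drop p<r r<q (there r∈cs) = r∈cs

  -- `ρ-⋖` concerns covers only; finiteness extends it to all strict relations.
  ρ-mono : ∀ {p q} → p < q → ρ p ℕ.< ρ q
  ρ-mono p<q = ρ-mono-⊆ elements p<q λ {r} _ _ → elements-complete r

  ∈-[⟩ : ∀ {u v z} → z ∈ [ u , v ⟩ → u ≤ z × z < v
  ∈-[⟩ {u} {v} z∈ = proj₂ (∈-filter⁻ (λ z → u ≤? z ×-dec z <? v) {xs = elements} z∈)

  ∈-⟨⟩ : ∀ {u v z} → z ∈ ⟨ u , v ⟩ → u < z × z < v
  ∈-⟨⟩ {u} {v} z∈ = proj₂ (∈-filter⁻ (λ z → u <? z ×-dec z <? v) {xs = elements} z∈)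

  -- Both lists are free of duplicates and have the same members, hence agree as bags. This isolates
  -- the summand of the minimum.
  [⟩↭∷⟨⟩ : ∀ {u v} → u < v → [ u , v ⟩ ↭ u ∷ ⟨ u , v ⟩
  [⟩↭∷⟨⟩ {u} {v} u<v = ∼bag⇒↭ (unique∧set⇒bag
    (filter⁺ _ elements-unique)
    (All.tabulate (λ r∈ → proj₂ (proj₁ (∈-⟨⟩ r∈))) AllPairs.∷ filter⁺ _ elements-unique)
    (mk⇔ to from))
    where
    to : ∀ {z} → z ∈ [ u , v ⟩ → z ∈ u ∷ ⟨ u , v ⟩
    to {z} z∈ with z ≟ u | ∈-[⟩ z∈
    ... | yes z≡u | _         = here z≡u
    ... | no  z≢u | u≤z , z<v =
      there (∈-filter⁺ (λ z → u <? z ×-dec z <? v) (elements-complete z) ((u≤z , z≢u ∘ sym) , z<v))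
    from : ∀ {z} → z ∈ u ∷ ⟨ u , v ⟩ → z ∈ [ u , v ⟩
    from (here refl) =
      ∈-filter⁺ (λ z → u ≤? z ×-dec z <? v) (elements-complete _) (≤.refl , u<v)
    from (there z∈) with (u≤z , _) , z<v ← ∈-⟨⟩ z∈ =
      ∈-filter⁺ (λ z → u ≤? z ×-dec z <? v) (elements-complete _) (u≤z , z<v)

  -- Unfolding the recursion for f and g

  fFrom-suc : ∀ g {p n} → ρ p ≡ suc n →
              fFrom P g p ≡ ∑ [ 0̂ , p ⟩ λ q → g q * (x - 1ᴸ) ^ (n ∸ ρ q)
  fFrom-suc g eq rewrite eq = refl

  gFrom-zero : ∀ f {p} → ρ p ≡ 0 → gFrom P f p ≡ 1ᴸ
  gFrom-zero f eq rewrite eq = refl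

  gFrom-suc : ∀ f {p n} → ρ p ≡ suc n → gFrom P f p ≡ gPolynomial n f
  gFrom-suc f eq rewrite eq = refl

  -- The sum runs over elements strictly below `p`, whose ranks are at most `n` by `ρ-mono`.
  fFrom-cong : ∀ {g g′ p n} → ρ p ≡ suc n → (∀ q → ρ q ≤ℕ n → g q ≡ g′ q) → fFrom P g p ≡ fFrom P g′ p
  fFrom-cong {g} {g′} {p} {n} eq g≡g′ = trans (fFrom-suc g eq) (trans
    (∑-cong [ 0̂ , p ⟩ λ {q} q∈ → cong (_* (x - 1ᴸ) ^ (n ∸ ρ q))
      (g≡g′ q (ℕ.s≤s⁻¹ (subst (ρ q ℕ.<_) eq (ρ-mono (proj₂ (∈-[⟩ q∈)))))))
    (sym (fFrom-suc g′ eq)))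

  toricG′-zero : ∀ k {p} → ρ p ≡ 0 → toricG′ P k p ≡ 1ᴸ
  toricG′-zero zero    eq = refl
  toricG′-zero (suc k) eq = gFrom-zero _ eq

  -- Unfolding g at an element of rank n + 1 evaluates everything below it at depth n, whereas
  -- `toricG` evaluates each element at its own rank; this reconciles the two.
  toricG′-stable : ∀ k k′ p → ρ p ≤ℕ k → ρ p ≤ℕ k′ → toricG′ P k p ≡ toricG′ P k′ p
  toricG′-stable k k′ p ρ≤k ρ≤k′ with ρ p in eq
  ... | zero  = trans (toricG′-zero k eq) (sym (toricG′-zero k′ eq))
  toricG′-stable (suc k) (suc k′) p (ℕ.s≤s n≤k) (ℕ.s≤s n≤k′) | suc n = cong (λ f → gFrom P f p)
    (fFrom-cong eq λ q ρ≤n → toricG′-stable k k′ q (ℕ.≤-trans ρ≤n n≤k) (ℕ.≤-trans ρ≤n n≤k′))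

  toricG-zero : ∀ {p} → ρ p ≡ 0 → toricG P p ≡ 1ᴸ
  toricG-zero {p} = toricG′-zero (ρ p)

  toricG-suc : ∀ {p n} → ρ p ≡ suc n → toricG P p ≡ gPolynomial n (toricF P p)
  toricG-suc {p} {n} eq = begin
    toricG′ P (ρ p) p                        ≡⟨ cong (λ k → toricG′ P k p) eq ⟩
    gFrom P (fFrom P (toricG′ P n) p) p      ≡⟨ gFrom-suc _ eq ⟩
    gPolynomial n (fFrom P (toricG′ P n) p)
      ≡⟨ cong (gPolynomial n) (fFrom-cong eq λ q ρ≤n → toricG′-stable n (ρ q) q ρ≤n ℕ.≤-refl) ⟩
    gPolynomial n (toricF P p)               ∎
    where open ≡-Reasoning

  isShortToricOf : ∀ {p q n} → ρ p ≡ suc n → IsShortToric P p q → IsShortToricOf n (toricF P p) q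
  isShortToricOf {p} {q} {n} eq short =
    subst (λ f → IsShortToricOf n f q) (sym (fFrom-suc (toricG P) eq)) (unfold eq short)
    where
    -- `IsShortToric` and `toricF` both branch on `ρ p`. With the sum written out, the goal does not
    -- mention `ρ p`, on which the case split abstracts.
    unfold : ρ p ≡ suc n → IsShortToric P p q →
             IsShortToricOf n (∑ [ 0̂ , p ⟩ λ r → toricG P r * (x - 1ᴸ) ^ (n ∸ ρ r)) q
    unfold eq short with ρ p in eq′
    unfold refl short | .(suc n) = subst (λ f → IsShortToricOf n f q) (fFrom-suc (toricG P) eq′) short

  homogenize-toricF : ∀ {p n} → ρ p ≡ suc n → homogenize n (toricF P p)
    ≡ ∑ [ 0̂ , p ⟩ λ q → homogenize (ρ q) (toricG P q) * (x⁻¹ - x) ^ (n ∸ ρ q)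
  homogenize-toricF {p} {n} eq = begin
    homogenize n (toricF P p)
      ≡⟨ cong (homogenize n) (fFrom-suc (toricG P) eq) ⟩
    homogenize n (∑ [ 0̂ , p ⟩ λ q → toricG P q * (x - 1ᴸ) ^ (n ∸ ρ q))
      ≡⟨ homogenize-∑ n [ 0̂ , p ⟩ _ ⟩
    (∑ [ 0̂ , p ⟩ λ q → homogenize n (toricG P q * (x - 1ᴸ) ^ (n ∸ ρ q)))
      ≡⟨ ∑-cong [ 0̂ , p ⟩ (λ {q} q∈ →
           summand q (ℕ.s≤s⁻¹ (subst (ρ q ℕ.<_) eq (ρ-mono (proj₂ (∈-[⟩ q∈)))))) ⟩
    (∑ [ 0̂ , p ⟩ λ q → homogenize (ρ q) (toricG P q) * (x⁻¹ - x) ^ (n ∸ ρ q)) ∎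
    where
    open ≡-Reasoning
    summand : ∀ q → ρ q ≤ℕ n → homogenize n (toricG P q * (x - 1ᴸ) ^ (n ∸ ρ q))
            ≡ homogenize (ρ q) (toricG P q) * (x⁻¹ - x) ^ (n ∸ ρ q)
    summand q ρ≤n = begin
      homogenize n (toricG P q * (x - 1ᴸ) ^ (n ∸ ρ q))
        -- The bound on `ρ q` makes the truncated subtraction exact, so the weight n splits between
        -- the two factors.
        ≡⟨ cong (λ m → homogenize m (toricG P q * (x - 1ᴸ) ^ (n ∸ ρ q))) (ℕ.m+[n∸m]≡n ρ≤n) ⟨
      homogenize (ρ q ℕ.+ (n ∸ ρ q)) (toricG P q * (x - 1ᴸ) ^ (n ∸ ρ q))
        ≡⟨ homogenize-* (ρ q) (n ∸ ρ q) (toricG P q) _ ⟩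
      homogenize (ρ q) (toricG P q) * homogenize (n ∸ ρ q) ((x - 1ᴸ) ^ (n ∸ ρ q))
        ≡⟨ cong (homogenize (ρ q) (toricG P q) *_) (homogenize-^ (n ∸ ρ q)) ⟩
      homogenize (ρ q) (toricG P q) * (x⁻¹ - x) ^ (n ∸ ρ q) ∎

  homogenize-toricG : ∀ {p q} → 0̂ < p → IsShortToric P p q →
                      homogenize (ρ p) (toricG P p) ≈ U≥ (+ 1) (q * (x - x⁻¹))
  homogenize-toricG {p} {q} 0̂<p short = subst₂ (λ m g → homogenize m g ≈ U≥ (+ 1) (q * (x - x⁻¹)))
    (sym eq) (sym (toricG-suc eq)) (homogenize-gPolynomial (isShortToricOf eq short))
    where
    eq : ρ p ≡ suc (ρ p ∸ 1)
    eq = sym (ℕ.m+[n∸m]≡n (ℕ.≤-trans (ℕ.s≤s ℕ.z≤n) (ρ-mono 0̂<p)))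

-- The recurrence for the short toric polynomial

theorem3p4 : ∀ {a ℓ} (P : GradedPoset a ℓ) → let open GradedPoset P in
    IsEulerian → 1 ≤ℕ rank →
    (t : Carrier → Laurent) → (∀ p → IsShortToric P p (t p)) →
    t 1̂ ≈ U≥ (+ 0) ((x⁻¹ - x) ^ (rank ∸ 1)
    + ∑ ⟨ 0̂ , 1̂ ⟩ λ p → U≥ (+ 1) (t p * (x - x⁻¹)) * (x⁻¹ - x) ^ (rank ∸ ρ p ∸ 1))
theorem3p4 P _ 1≤rank t short k =
  trans (short≈U≥0 (isShortToricOf P rank≡1+n (short 1̂)) k)
        (U≥-cong (homogenize n (toricF P 1̂)) ((x⁻¹ - x) ^ n + ∑ ⟨ 0̂ , 1̂ ⟩ summand) recurrence k)
  where
  open GradedPoset P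
  n = rank ∸ 1

  term summand : Carrier → Laurent
  term p    = homogenize (ρ p) (toricG P p) * (x⁻¹ - x) ^ (n ∸ ρ p)
  summand p = U≥ (+ 1) (t p * (x - x⁻¹)) * (x⁻¹ - x) ^ (rank ∸ ρ p ∸ 1)

  rank≡1+n : rank ≡ suc n
  rank≡1+n = sym (ℕ.m+[n∸m]≡n 1≤rank)

  0̂<1̂ : 0̂ < 1̂
  0̂<1̂ = minimum 1̂ , λ 0̂≡1̂ → ℕ.<⇒≢ 1≤rank (trans (sym ρ-0̂) (cong ρ 0̂≡1̂))

  term-0̂ : term 0̂ ≡ (x⁻¹ - x) ^ n
  -- As g(∅,x) = 1 and the minimum has rank 0, the first factor computes to `1ᴸ`; what remains is
  -- the power standing outside the sum.
  term-0̂ = trans (cong₂ (λ m g → homogenize m g * (x⁻¹ - x) ^ (n ∸ m)) ρ-0̂ (toricG-zero P ρ-0̂))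
                 (*-identityˡ _)

  exponent : ∀ p → n ∸ ρ p ≡ rank ∸ ρ p ∸ 1
  exponent p = trans (ℕ.∸-+-assoc rank 1 (ρ p))
    (trans (cong (rank ∸_) (ℕ.+-comm 1 (ρ p))) (sym (ℕ.∸-+-assoc rank (ρ p) 1)))

  term≈summand : ∀ {p} → p ∈ ⟨ 0̂ , 1̂ ⟩ → term p ≈ summand p
  term≈summand {p} p∈ i = trans
    (*-congʳ (homogenize (ρ p) (toricG P p)) (U≥ (+ 1) (t p * (x - x⁻¹)))
      (homogenize-toricG P (proj₁ (∈-⟨⟩ P p∈)) (short p)) ((x⁻¹ - x) ^ (n ∸ ρ p)) i)
    (cong (λ m → coeff (U≥ (+ 1) (t p * (x - x⁻¹)) * (x⁻¹ - x) ^ m) i) (exponent p))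

  recurrence : homogenize n (toricF P 1̂) ≈ (x⁻¹ - x) ^ n + ∑ ⟨ 0̂ , 1̂ ⟩ summand
  recurrence k = trans (cong (λ p → coeff p k) (homogenize-toricF P rank≡1+n))
    -- The summand of the minimum is moved to the front; the others are replaced one by one, only up
    -- to `_≈_`.
    (trans (∑-↭ term ([⟩↭∷⟨⟩ P 0̂<1̂) k)
    (+-cong (term 0̂) ((x⁻¹ - x) ^ n) (∑ ⟨ 0̂ , 1̂ ⟩ term) (∑ ⟨ 0̂ , 1̂ ⟩ summand)
      (λ i → cong (λ p → coeff p i) term-0̂) (∑-cong-≈ ⟨ 0̂ , 1̂ ⟩ term summand term≈summand) k))
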